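{- Consider formal expressions which are finite sums (with multiplicities) of finite products of factors $s_{ab}=\sin(\theta_b-\theta_a)$, $a<b$ natural numbers, where the $\theta_i$ are indeterminate angles. Formally, a product is a finite multiset of 2-element subsets of $\mathbb{N}$ and an expression is a finite multiset of products. An expansion step applies the identity $\sin(\theta_c-\theta_a)\sin(\theta_d-\theta_b)=\sin(\theta_b-\theta_a)\sin(\theta_d-\theta_c)+\sin(\theta_d-\theta_a)\sin(\theta_c-\theta_b)$ with $a<b<c<d$: one chooses a product $p$ in the expression containing (as members of the multiset) both $\{a,c\}$ and $\{b,d\}$ with $a<b<c<d$, removes one copy of $p$ from the expression, and adds the two products obtained from $p$ by replacing one copy each of $\{a,c\},\{b,d\}$ by $\{a,b\},\{c,d\}$, respectively by $\{a,d\},\{b,c\}$. Then, starting from any expression, repeated application of expansion steps always terminates, and the expression reached when no expansion step applies (the normal form) is uniquely determined by the starting expression.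
   Context: Multisets: a product may contain the same pair several times, and an expression may contain the same product several times; removal and addition are multiset operations. Each expansion step does not change the value of the expression as a function of the $\theta_i$. -}

module Defs where

open import Data.List.Base using (List; _∷_)
open import Data.List.Relation.Binary.Permutation.Propositional using (_↭_; ↭-setoid)
import Data.List.Relation.Binary.Permutation.Setoid as SetoidPermutation
open import Data.Nat.Base using (ℕ; _<_)
open import Data.Nat.Properties using (<-trans)
open import Level using (0ℓ)
open import Relation.Binary.Bundles using (Setoid)
open import Relation.Binary.Core using (Rel)
open import Relation.Binary.Construct.Closure.ReflexiveTransitive using (Star)

-- A 2-element subset {a, b} of ℕ, given by its elements in increasing order;
-- it stands for the factor s_ab = sin (θ_b - θ_a).  The proof of a < b is
-- irrelevant, so propositional equality is equality of subsets.
record Pair : Set where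
  constructor pair
  field
    lo hi  : ℕ
    .lo<hi : lo < hi

-- Finite multisets are lists up to permutation.  The equality of expressions
-- permutes the products and also permutes the pairs inside each product.
Product : Set
Product = List Pair

productSetoid : Setoid 0ℓ 0ℓ
productSetoid = ↭-setoid {A = Pair}

Expression : Set
Expression = List Product

infix 4 _≈_ _⟶_ _⟶*_

_≈_ : Rel Expression 0ℓ
_≈_ = SetoidPermutation._↭_ productSetoid

-- Expands p q₁ q₂: the product p rewrites to the sum q₁ + q₂ by
--   s_ac s_bd = s_ab s_cd + s_ad s_bc   (a < b < c < d),
-- with r the multiset of the factors of p left untouched.
data Expands (p q₁ q₂ : Product) : Set where
  expands : ∀ {a b c d} (a<b : a < b) (b<c : b < c) (c<d : c < d) (r : Product) →
    p  ↭ pair a c (<-trans a<b b<c) ∷ pair b d (<-trans b<c c<d) ∷ r →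
    q₁ ↭ pair a b a<b ∷ pair c d c<d ∷ r →
    q₂ ↭ pair a d (<-trans a<b (<-trans b<c c<d)) ∷ pair b c b<c ∷ r →
    Expands p q₁ q₂

data _⟶_ (E E′ : Expression) : Set where
  step : ∀ {p q₁ q₂} (R : Expression) →
    Expands p q₁ q₂ →
    E  ≈ p ∷ R →
    E′ ≈ q₁ ∷ q₂ ∷ R →
    E ⟶ E′

_⟶*_ : Rel Expression 0ℓ
_⟶*_ = Star _⟶_

{-# OPTIONS --safe #-}

-- Termination: each step preserves Σ_p ∏_{ab ∈ p} (b - a), by the same identity
-- with sin dropped, and adds one product; every product contributes at least 1,
-- so the number of products is bounded by an invariant.
--
-- Uniqueness: substitute x_a y_b - x_b y_a for s_ab, an invariant of the steps.
-- A normal form is a sum of non-crossing products.  The part of ∏ (x_a y_b - x_b y_a)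
-- of largest weight, where y_b weighs b and x_a weighs 0, is the single monomial
-- ∏ x_a y_b, and it determines a non-crossing product.  So two normal forms of equal
-- polynomial share a product of maximal weight, which can be cancelled.
module Submission where

open import Defs

open import Algebra.Bundles using (AbelianGroup; CommutativeMonoid)
import Algebra.Properties.Group as GroupProperties
open import Data.Bool.Base using (true; false; if_then_else_)
open import Data.Integer.Base as ℤ using (ℤ; +_; 0ℤ; 1ℤ)
import Data.Integer.Properties as ℤ
import Data.Integer.Tactic.RingSolver as ℤ-Solver
open import Data.List.Base using (List; []; _∷_; _++_; map; foldr; filter; length)
open import Data.List.Extrema.Nat
  using (argmin; argmin-sel; f[argmin]≤f[⊤]; f[argmin]≤f[xs];
         argmax; argmax-sel; f[⊥]≤f[argmax]; f[xs]≤f[argmax])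
open import Data.List.Membership.Propositional using (_∈_; find; lose)
open import Data.List.Membership.Propositional.Properties
  using (∈-∃++; ∈-++⁻; ∈-++⁺ˡ; ∈-++⁺ʳ; ∈-map⁺; ∈-map⁻)
import Data.List.Membership.DecPropositional as DecMembership
open import Data.List.Properties using (filter-some; filter-none)
open import Data.List.Relation.Binary.Permutation.Propositional
  using (_↭_; refl; prep; swap; trans; ↭-refl; ↭-sym)
open import Data.List.Relation.Binary.Permutation.Propositional.Properties
  using (∈-resp-↭; ↭-length; shift; drop-∷; map⁺)
import Data.List.Relation.Binary.Permutation.Setoid as SetoidPermutation
import Data.List.Relation.Binary.Permutation.Setoid.Properties as SetoidPermutationₚ
open import Data.List.Relation.Unary.All as All using (All; []; _∷_)
open import Data.List.Relation.Unary.All.Properties using (¬Any⇒All¬; ++⁺; ++⁻)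
open import Data.List.Relation.Unary.Any as Any using (Any; here; there; any?)
open import Data.Nat.Base using (ℕ; suc; _+_; _*_; _∸_; _≤_; _<_; s≤s; z≤n)
open import Data.Nat.Induction using (<-wellFounded)
open import Data.Nat.ListAction using (sum; product)
open import Data.Nat.ListAction.Properties using (sum-↭; product-↭)
import Data.Nat.Properties as ℕ
open import Data.Nat.Tactic.RingSolver using (solve-∀)
open import Data.Product.Base using (_×_; _,_; ∃₂; ∃-syntax)
open import Data.Sum.Base using (_⊎_; inj₁; inj₂; [_,_]′)
open import Function.Base using (_∘_; flip)
open import Function.Bundles using (mk⇔)
open import Induction.WellFounded using (Acc; acc; module Subrelation)
import Relation.Binary.Construct.On as On
open import Relation.Binary.Construct.Closure.ReflexiveTransitive using (ε; _◅_)
open import Relation.Binary.Definitions using (Decidable; DecidableEquality)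
open import Relation.Binary.PropositionalEquality
  using (_≡_; refl; sym; cong; cong₂; module ≡-Reasoning)
  renaming (trans to ≡-trans)
open import Relation.Binary.Rewriting using (StronglyNormalizing; IsNormalForm)
open import Relation.Nullary using (¬_; Dec; yes; no; does; contradiction)
open import Relation.Nullary.Decidable using (_×-dec_; map′; recompute; does-⇔; dec-false)
open import Relation.Unary as Unary using (Pred)

open Pair
open SetoidPermutation productSetoid using (↭-prep) renaming
  (prep to ≈-prep; swap to ≈-swap; trans to ≈-trans;
   ↭-refl to ≈-refl; ↭-sym to ≈-sym)
module ≈ₚ = SetoidPermutationₚ productSetoid

-- Permutations, and additive functions on expressions

module _ {A : Set} where

  ∈⇒↭∷ : ∀ {x : A} {xs} → x ∈ xs → ∃[ ys ] xs ↭ x ∷ ys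
  ∈⇒↭∷ x∈xs with as , bs , refl ← ∈-∃++ x∈xs = as ++ bs , shift _ as bs

  module _ (_≟_ : DecidableEquality A) where
    open DecMembership _≟_ using (_∈?_)

    infix 4 _↭?_
    _↭?_ : Decidable (_↭_ {A = A})
    []     ↭? []      = yes refl
    []     ↭? _ ∷ _   = no λ p → contradiction (↭-length p) λ ()
    x ∷ xs ↭? ys with x ∈? ys
    ... | no x∉ys  = no λ p → x∉ys (∈-resp-↭ p (here refl))
    ... | yes x∈ys with zs , ys↭ ← ∈⇒↭∷ x∈ys =
      map′ (λ p → trans (prep x p) (↭-sym ys↭)) (λ p → drop-∷ (trans p ys↭)) (xs ↭? zs)

Any-≈ : ∀ {q E} → Any (q ↭_) E → ∃[ R ] E ≈ q ∷ R
Any-≈ {E = p ∷ E} (here q↭p)  = E , ≈-prep (↭-sym q↭p) ≈-refl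
Any-≈ {E = p ∷ E} (there q∈E) with R , E≈ ← Any-≈ q∈E =
  p ∷ R , ≈-trans (↭-prep p E≈) (≈-swap ↭-refl ↭-refl ≈-refl)

-- Source of both step invariants: `M` is ℕ with `volume` for termination, and ℤ with the pairing
-- against a functional for uniqueness.
module Total {c} (M : CommutativeMonoid c c)
             (g : Product → CommutativeMonoid.Carrier M) where
  private module M = CommutativeMonoid M
  open M using (Carrier; _∙_) renaming (_≈_ to _≈ᴹ_)

  total : Expression → Carrier
  total E = foldr _∙_ M.ε (map g E)

  module _ (g-↭ : ∀ {p q} → p ↭ q → g p ≈ᴹ g q) where

    total-≈ : ∀ {E F} → E ≈ F → total E ≈ᴹ total F
    total-≈ E≈F = SetoidPermutationₚ.foldr-commMonoid M.setoid M.isCommutativeMonoid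
                    (≈ₚ.map⁺ M.setoid g-↭ E≈F)

    total-⟶ : (∀ {p q₁ q₂} → Expands p q₁ q₂ → g p ≈ᴹ (g q₁ ∙ g q₂)) →
              ∀ {E F} → E ⟶ F → total E ≈ᴹ total F
    total-⟶ g-expands (step R e E≈ F≈) =
      M.trans (total-≈ E≈)
      (M.trans (M.∙-congʳ (g-expands e))
      (M.trans (M.assoc _ _ _) (M.sym (total-≈ F≈))))

-- Termination

-- The field `lo<hi` is irrelevant, so its proof is rebuilt by deciding the inequality.
lo<hi′ : ∀ x → lo x < hi x
lo<hi′ (pair a b a<b) = recompute (a ℕ.<? b) a<b

len : Pair → ℕ
len x = hi x ∸ lo x

volume : Product → ℕ
volume p = product (map len p)

volume-↭ : ∀ {p q} → p ↭ q → volume p ≡ volume q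
volume-↭ = product-↭ ∘ map⁺ len

1≤volume : ∀ p → 1 ≤ volume p
1≤volume []      = s≤s z≤n
1≤volume (x ∷ p) = ℕ.*-mono-≤ (ℕ.m<n⇒0<n∸m (lo<hi′ x)) (1≤volume p)

∸-split : ∀ {a b c} → a ≤ b → b ≤ c → c ∸ a ≡ (b ∸ a) + (c ∸ b)
∸-split {a} {b} {c} a≤b b≤c = begin
  c ∸ a              ≡⟨ cong (_∸ a) (ℕ.m+[n∸m]≡n b≤c) ⟨
  (b + (c ∸ b)) ∸ a  ≡⟨ ℕ.+-∸-comm (c ∸ b) a≤b ⟩
  (b ∸ a) + (c ∸ b)  ∎
  where open ≡-Reasoning

-- Here `i`, `j`, `k` are the gaps b - a, c - b, d - c, and `v` is the volume of the untouched
-- factors.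
volume-identity : ∀ i j k v → (i + j) * ((j + k) * v) ≡ i * (k * v) + (i + (j + k)) * (j * v)
volume-identity = solve-∀

volume-expands : ∀ {p q₁ q₂} → Expands p q₁ q₂ → volume p ≡ volume q₁ + volume q₂
volume-expands (expands {a} {b} {c} {d} a<b b<c c<d r p↭ q₁↭ q₂↭)
  rewrite volume-↭ p↭ | volume-↭ q₁↭ | volume-↭ q₂↭
        | ∸-split (ℕ.<⇒≤ a<b) (ℕ.<⇒≤ (ℕ.<-trans b<c c<d))
        | ∸-split (ℕ.<⇒≤ a<b) (ℕ.<⇒≤ b<c)
        | ∸-split (ℕ.<⇒≤ b<c) (ℕ.<⇒≤ c<d)
  = volume-identity (b ∸ a) (c ∸ b) (d ∸ c) (volume r)

open Total ℕ.+-0-commutativeMonoid volume using ()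
  renaming (total to totalVolume; total-⟶ to totalVolume-⟶)

length≤totalVolume : ∀ E → length E ≤ totalVolume E
length≤totalVolume []      = z≤n
length≤totalVolume (p ∷ E) = ℕ.+-mono-≤ (1≤volume p) (length≤totalVolume E)

⟶-length : ∀ {E F} → E ⟶ F → length F ≡ suc (length E)
⟶-length (step _ _ E≈ F≈) =
  ≡-trans (≈ₚ.xs↭ys⇒|xs|≡|ys| F≈) (cong suc (sym (≈ₚ.xs↭ys⇒|xs|≡|ys| E≈)))

-- By `length≤totalVolume` nothing is truncated here, so each step lowers this by exactly one.
slack : Expression → ℕ
slack E = totalVolume E ∸ length E

⟶-slack : ∀ {E F} → E ⟶ F → slack F < slack E
⟶-slack {E} {F} E⟶F rewrite totalVolume-⟶ volume-↭ volume-expands E⟶F =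
  ℕ.∸-monoʳ-< (ℕ.≤-reflexive (sym (⟶-length E⟶F))) (length≤totalVolume F)

⟶-stronglyNormalizing : StronglyNormalizing _⟶_
⟶-stronglyNormalizing =
  Subrelation.wellFounded ⟶-slack (On.wellFounded slack <-wellFounded)

-- Non-crossing products

Crosses : Pair → Pair → Set
Crosses x y = lo x < lo y × lo y < hi x × hi x < hi y

crosses? : Decidable Crosses
crosses? x y = (lo x ℕ.<? lo y) ×-dec (lo y ℕ.<? hi x) ×-dec (hi x ℕ.<? hi y)

NonCrossing : Product → Set
NonCrossing p = ∀ {x y} → x ∈ p → y ∈ p → ¬ Crosses x y

NonCrossing-↭ : ∀ {p q} → p ↭ q → NonCrossing p → NonCrossing q
NonCrossing-↭ p↭q nc x∈q y∈q = nc (∈-resp-↭ (↭-sym p↭q) x∈q) (∈-resp-↭ (↭-sym p↭q) y∈q)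

Expandable : Product → Set
Expandable p = ∃₂ λ q₁ q₂ → Expands p q₁ q₂

crossing⇒expandable : ∀ {p x y} → x ∈ p → y ∈ p → Crosses x y → Expandable p
crossing⇒expandable x∈p y∈p (a<b , b<c , c<d)
  with p′ , p↭ ← ∈⇒↭∷ x∈p
  with ∈-resp-↭ p↭ y∈p
-- A pair does not cross itself, so `y` has a position of its own and both pairs can be split off.
... | here refl   = contradiction a<b (ℕ.<-irrefl refl)
... | there y∈p′ with r , p′↭ ← ∈⇒↭∷ y∈p′ =
  _ , _ , expands a<b b<c c<d r (trans p↭ (prep _ p′↭)) refl refl

nonCrossing⇒¬expandable : ∀ {p} → NonCrossing p → ¬ Expandable p
nonCrossing⇒¬expandable nc (_ , _ , expands a<b b<c c<d _ p↭ _ _) =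
  nc (∈-resp-↭ (↭-sym p↭) (here refl)) (∈-resp-↭ (↭-sym p↭) (there (here refl)))
     (a<b , b<c , c<d)

expandable⊎nonCrossing : ∀ p → Expandable p ⊎ NonCrossing p
expandable⊎nonCrossing p with any? (λ x → any? (crosses? x) p) p
... | no ¬crossing = inj₂ λ x∈p y∈p xy → ¬crossing (lose x∈p (lose y∈p xy))
... | yes crossing with x , x∈p , x-crosses ← find crossing
                   with y , y∈p , xy ← find x-crosses = inj₁ (crossing⇒expandable x∈p y∈p xy)

nonCrossing⇒normal : ∀ {E} → All NonCrossing E → IsNormalForm _⟶_ E
nonCrossing⇒normal ncs (_ , step _ e E≈ _) =
  nonCrossing⇒¬expandable (All.head (≈ₚ.All-resp-↭ NonCrossing-↭ E≈ ncs)) (_ , _ , e)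

reducible⊎nonCrossing : ∀ E → (∃[ F ] E ⟶ F) ⊎ All NonCrossing E
reducible⊎nonCrossing []      = inj₂ []
reducible⊎nonCrossing (p ∷ E) with expandable⊎nonCrossing p | reducible⊎nonCrossing E
... | inj₁ (_ , _ , e) | _                = inj₁ (_ , step E e ≈-refl ≈-refl)
... | inj₂ nc | inj₂ ncs                  = inj₂ (nc ∷ ncs)
... | inj₂ _  | inj₁ (_ , step R e E≈ F≈) =
  inj₁ (_ , step (p ∷ R) e (≈-trans (↭-prep p E≈) (≈-swap ↭-refl ↭-refl ≈-refl)) ≈-refl)

normal⇒nonCrossing : ∀ {E} → IsNormalForm _⟶_ E → All NonCrossing E
normal⇒nonCrossing {E} nf with reducible⊎nonCrossing E
... | inj₁ red = contradiction red nf
... | inj₂ ncs = ncs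

normalize : ∀ E → ∃[ N ] (All NonCrossing N × E ⟶* N)
normalize E = go E (⟶-stronglyNormalizing E)
  where
  go : ∀ E → Acc (flip _⟶_) E → ∃[ N ] (All NonCrossing N × E ⟶* N)
  go E (acc rs) with reducible⊎nonCrossing E
  ... | inj₂ ncs       = E , ncs , ε
  ... | inj₁ (F , E⟶F) with N , ncs , F⟶*N ← go F (rs E⟶F) = N , ncs , E⟶F ◅ F⟶*N

-- Non-crossing products are determined by their end points

-- Equality of the leading monomials ∏ x_a y_b: which lower end goes with which upper end is
-- forgotten.
SameEnds : Product → Product → Set
SameEnds p q = map lo p ↭ map lo q × map hi p ↭ map hi q

-- A pair of q that starts at lo z, being no shorter than z, ends at or after hi z, and
-- a pair that ends at hi z starts at or before lo z: they cross unless one of them is z.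
shortest∈ : ∀ {q z} → NonCrossing q → lo z ∈ map lo q → hi z ∈ map hi q →
            (∀ {x} → x ∈ q → len z ≤ len x) → z ∈ q
shortest∈ {q} {z} nc lo∈ hi∈ shortest
  with x , x∈q , refl ← ∈-map⁻ lo lo∈
  with y , y∈q , refl ← ∈-map⁻ hi hi∈
  with ℕ.m≤n⇒m<n∨m≡n hi-z≤hi-x | ℕ.m≤n⇒m<n∨m≡n lo-y≤lo-z
  where
  hi-z≤hi-x : hi z ≤ hi x
  hi-z≤hi-x = ℕ.≮⇒≥ λ h → ℕ.<⇒≱ (ℕ.∸-monoˡ-< h (ℕ.<⇒≤ (lo<hi′ x))) (shortest x∈q)

  lo-y≤lo-z : lo y ≤ lo z
  lo-y≤lo-z = ℕ.∸-cancelʳ-≤ (ℕ.<⇒≤ (lo<hi′ y)) (shortest y∈q)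
... | inj₂ refl | _         = x∈q
... | inj₁ _    | inj₂ refl = y∈q
... | inj₁ h    | inj₁ l    = contradiction (l , lo<hi′ z , h) (nc y∈q x∈q)

-- Take a pair `z` that is shortest among both products together. Whichever product it comes from,
-- its ends occur in the other one, and `shortest∈` puts it there.
common-pair : ∀ {x p q} → NonCrossing (x ∷ p) → NonCrossing q → SameEnds (x ∷ p) q →
              ∃[ z ] (z ∈ x ∷ p × z ∈ q)
common-pair {x} {p} {q} p-nc q-nc (los , his) =
  z , [ (λ z∈p → z∈p ,
           shortest∈ {z = z} q-nc (∈-resp-↭ los (∈-map⁺ lo z∈p)) (∈-resp-↭ his (∈-map⁺ hi z∈p))
             (All.lookup shortest ∘ ∈-++⁺ʳ (x ∷ p)))
      , (λ z∈q →
           shortest∈ {z = z} p-nc (∈-resp-↭ (↭-sym los) (∈-map⁺ lo z∈q))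
                                  (∈-resp-↭ (↭-sym his) (∈-map⁺ hi z∈q))
             (All.lookup shortest ∘ ∈-++⁺ˡ)
           , z∈q)
      ]′ (∈-++⁻ (x ∷ p) z∈)
  where
  z = argmin len x (p ++ q)

  z∈ : z ∈ x ∷ p ++ q
  z∈ = [ here , there ]′ (argmin-sel len x (p ++ q))

  shortest : All (λ y → len z ≤ len y) (x ∷ p ++ q)
  shortest = f[argmin]≤f[⊤] {f = len} x (p ++ q) ∷ f[argmin]≤f[xs] x (p ++ q)

-- Removing a common pair from both products keeps them non-crossing with the same ends; induct on
-- the length.
sameEnds⇒↭ : ∀ {p q} → NonCrossing p → NonCrossing q → SameEnds p q → p ↭ q
sameEnds⇒↭ {p} = go (<-wellFounded (length p))
  where
  go : ∀ {p q} → Acc _<_ (length p) →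
       NonCrossing p → NonCrossing q → SameEnds p q → p ↭ q
  go {[]}    {[]}    _ _ _ _         = refl
  go {[]}    {_ ∷ _} _ _ _ (los , _) = contradiction (↭-length los) λ ()
  go {_ ∷ _} {q} (acc rs) p-nc q-nc ends@(los , his)
    with z , z∈p , z∈q ← common-pair p-nc q-nc ends
    with p′ , p↭ ← ∈⇒↭∷ z∈p | q′ , q↭ ← ∈⇒↭∷ z∈q
    = trans p↭ (trans (prep z p′↭q′) (↭-sym q↭))
    where
    tail-nc : ∀ {r r′} → r ↭ z ∷ r′ → NonCrossing r → NonCrossing r′
    tail-nc r↭ nc x∈ y∈ = NonCrossing-↭ r↭ nc (there x∈) (there y∈)

    drop-end : ∀ (f : Pair → ℕ) → map f _ ↭ map f q → map f p′ ↭ map f q′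
    drop-end f ends = drop-∷ (trans (map⁺ f (↭-sym p↭)) (trans ends (map⁺ f q↭)))

    p′↭q′ : p′ ↭ q′
    p′↭q′ = go (rs (ℕ.≤-reflexive (sym (↭-length p↭))))
               (tail-nc p↭ p-nc) (tail-nc q↭ q-nc) (drop-end lo los , drop-end hi his)

-- The polynomial of a product

-- A linear functional on polynomials, given by its values on monomials: f as bs is its
-- value on the product of the x_a for a in as and the y_b for b in bs.
Functional : Set
Functional = List ℕ → List ℕ → ℤ

-- The variables commute, so a functional on polynomials must ignore the order of the indices.
Symmetric : Functional → Set
Symmetric f = ∀ {as as′ bs bs′} → as ↭ as′ → bs ↭ bs′ → f as bs ≡ f as′ bs′

-- The transpose of multiplication by x_a y_b.
times : ℕ → ℕ → Functional → Functional
times a b f as bs = f (a ∷ as) (b ∷ bs)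

times-symmetric : ∀ a b {f} → Symmetric f → Symmetric (times a b f)
times-symmetric a b sym-f as↭ bs↭ = sym-f (prep a as↭) (prep b bs↭)

-- ⟨ p , f ⟩ is the value of f on the product of x_a y_b - x_b y_a over the pairs of p.
⟨_,_⟩ : Product → Functional → ℤ
⟨ []             , f ⟩ = f [] []
⟨ pair a b _ ∷ p , f ⟩ = ⟨ p , times a b f ⟩ ℤ.- ⟨ p , times b a f ⟩

⟨,⟩-congʳ : ∀ p {f g} → (∀ as bs → f as bs ≡ g as bs) → ⟨ p , f ⟩ ≡ ⟨ p , g ⟩
⟨,⟩-congʳ []               f≗g = f≗g [] []
⟨,⟩-congʳ (pair a b _ ∷ p) f≗g = cong₂ ℤ._-_
  (⟨,⟩-congʳ p (λ as bs → f≗g (a ∷ as) (b ∷ bs)))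
  (⟨,⟩-congʳ p (λ as bs → f≗g (b ∷ as) (a ∷ bs)))

module _ {f : Functional} (sym-f : Symmetric f) (p : Product) where

  -- The monomial x_a x_c y_b y_d does not record which x came with which y.
  swap-x : ∀ a b c d → ⟨ p , times c d (times a b f) ⟩ ≡ ⟨ p , times a d (times c b f) ⟩
  swap-x a b c d = ⟨,⟩-congʳ p λ _ _ → sym-f (swap a c refl) refl

  swap-y : ∀ a b c d → ⟨ p , times c d (times a b f) ⟩ ≡ ⟨ p , times c b (times a d f) ⟩
  swap-y a b c d = ⟨,⟩-congʳ p λ _ _ → sym-f refl (swap b d refl)

  swap-xy : ∀ a b c d → ⟨ p , times c d (times a b f) ⟩ ≡ ⟨ p , times a b (times c d f) ⟩
  swap-xy a b c d = ≡-trans (swap-x a b c d) (swap-y c b a d)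

private
  interchange : ∀ i j k l → (i ℤ.- j) ℤ.- (k ℤ.- l) ≡ (i ℤ.- k) ℤ.- (j ℤ.- l)
  interchange = ℤ-Solver.solve-∀

  -- ij stands for the coefficient of the monomial with x_i x_j, the other two indices on y.
  plücker : ∀ ab ac ad bc bd cd →
    (ab ℤ.- ad) ℤ.- (bc ℤ.- cd) ≡
    ((ac ℤ.- ad) ℤ.- (bc ℤ.- bd)) ℤ.+ ((ab ℤ.- ac) ℤ.- (bd ℤ.- cd))
  plücker = ℤ-Solver.solve-∀

⟨,⟩-↭ : ∀ {p q f} → Symmetric f → p ↭ q → ⟨ p , f ⟩ ≡ ⟨ q , f ⟩
⟨,⟩-↭ sym-f refl                  = refl
⟨,⟩-↭ sym-f (prep (pair a b _) σ) =
  cong₂ ℤ._-_ (⟨,⟩-↭ (times-symmetric a b sym-f) σ) (⟨,⟩-↭ (times-symmetric b a sym-f) σ)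
⟨,⟩-↭ {f = f} sym-f (swap {ys = q} (pair a b _) (pair c d _) σ)
  rewrite ⟨,⟩-↭ (times-symmetric c d (times-symmetric a b sym-f)) σ
        | ⟨,⟩-↭ (times-symmetric d c (times-symmetric a b sym-f)) σ
        | ⟨,⟩-↭ (times-symmetric c d (times-symmetric b a sym-f)) σ
        | ⟨,⟩-↭ (times-symmetric d c (times-symmetric b a sym-f)) σ
        | swap-xy sym-f q a b c d | swap-xy sym-f q a b d c
        | swap-xy sym-f q b a c d | swap-xy sym-f q b a d c
  = interchange ⟨ q , times a b (times c d f) ⟩ ⟨ q , times a b (times d c f) ⟩
                ⟨ q , times b a (times c d f) ⟩ ⟨ q , times b a (times d c f) ⟩
⟨,⟩-↭ sym-f (trans σ τ) = ≡-trans (⟨,⟩-↭ sym-f σ) (⟨,⟩-↭ sym-f τ)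

-- This is the three-term Plücker relation between the 2×2 minors x_a y_b - x_b y_a.
⟨,⟩-expands : ∀ {p q₁ q₂ f} → Symmetric f → Expands p q₁ q₂ →
              ⟨ p , f ⟩ ≡ ⟨ q₁ , f ⟩ ℤ.+ ⟨ q₂ , f ⟩
⟨,⟩-expands {f = f} sym-f (expands {a} {b} {c} {d} a<b b<c c<d r p↭ q₁↭ q₂↭)
  rewrite ⟨,⟩-↭ sym-f p↭ | ⟨,⟩-↭ sym-f q₁↭ | ⟨,⟩-↭ sym-f q₂↭
        -- The three products have twelve terms but only six distinct monomials; each rewrite
        -- identifies two terms.
        | swap-y sym-f r a c b d | swap-y sym-f r a c d b
        | swap-x sym-f r c a b d | swap-x sym-f r c a d b
        | swap-y sym-f r a b c d | swap-x sym-f r b a d c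
  = plücker ⟨ r , times b c (times a d f) ⟩ ⟨ r , times c b (times a d f) ⟩
            ⟨ r , times d c (times a b f) ⟩ ⟨ r , times c d (times b a f) ⟩
            ⟨ r , times b c (times d a f) ⟩ ⟨ r , times c b (times d a f) ⟩

weight : Product → ℕ
weight p = sum (map hi p)

-- The leading monomial of p has coefficient 1, all the others weigh less.
⟨,⟩-leading : ∀ p {f} → (∀ as bs → sum bs < weight p → f as bs ≡ 0ℤ) →
              ⟨ p , f ⟩ ≡ f (map lo p) (map hi p)
⟨,⟩-leading []                       _      = refl
⟨,⟩-leading (x@(pair a b _) ∷ p) {f} f-low = begin
  ⟨ p , times a b f ⟩ ℤ.- ⟨ p , times b a f ⟩
    ≡⟨ cong₂ ℤ._-_ (⟨,⟩-leading p (λ as bs h → f-low _ _ (ℕ.+-monoʳ-< b h)))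
                   (⟨,⟩-leading p (λ as bs h → f-low _ _ (ℕ.+-mono-< (lo<hi′ x) h))) ⟩
  times a b f (map lo p) (map hi p) ℤ.- times b a f (map lo p) (map hi p)
    ≡⟨ cong (λ i → times a b f (map lo p) (map hi p) ℤ.- i)
            (f-low _ _ (ℕ.+-monoˡ-< (weight p) (lo<hi′ x))) ⟩
  times a b f (map lo p) (map hi p) ℤ.+ 0ℤ
    ≡⟨ ℤ.+-identityʳ _ ⟩
  times a b f (map lo p) (map hi p) ∎
  where open ≡-Reasoning

-- Linear independence of non-crossing products

ends? : ∀ q as bs → Dec (map lo q ↭ as × map hi q ↭ bs)
ends? q as bs = _↭?_ ℕ._≟_ (map lo q) as ×-dec _↭?_ ℕ._≟_ (map hi q) bs

sameEnds? : ∀ q p → Dec (SameEnds q p)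
sameEnds? q p = ends? q (map lo p) (map hi p)

-- Reads off the coefficient of the monomial ∏ x_a y_b of `q`.
leadingCoefficient : Product → Functional
leadingCoefficient q as bs = if does (ends? q as bs) then 1ℤ else 0ℤ

leadingCoefficient-symmetric : ∀ q → Symmetric (leadingCoefficient q)
leadingCoefficient-symmetric q {as} {as′} {bs} {bs′} as↭ bs↭ =
  cong (if_then 1ℤ else 0ℤ) (does-⇔ (mk⇔
    (λ (los , his) → trans los as↭ , trans his bs↭)
    (λ (los , his) → trans los (↭-sym as↭) , trans his (↭-sym bs↭)))
    (ends? q as bs) (ends? q as′ bs′))

leadingCoefficient-low : ∀ q as bs → sum bs < weight q → leadingCoefficient q as bs ≡ 0ℤ
leadingCoefficient-low q as bs light =
  cong (if_then 1ℤ else 0ℤ) (dec-false (ends? q as bs)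
    λ (_ , his) → ℕ.<⇒≢ light (sym (sum-↭ his)))

sumPairing : Functional → Expression → ℤ
sumPairing f = Total.total ℤ.+-0-commutativeMonoid ⟨_, f ⟩

infix 4 _≐_
-- Equality of the associated polynomials, tested by linear functionals so that no polynomial ring
-- has to be built.
_≐_ : Expression → Expression → Set
E ≐ F = ∀ {f} → Symmetric f → sumPairing f E ≡ sumPairing f F

≐-sym : ∀ {E F} → E ≐ F → F ≐ E
≐-sym E≐F sym-f = sym (E≐F sym-f)

≈⇒≐ : ∀ {E F} → E ≈ F → E ≐ F
≈⇒≐ E≈F sym-f = Total.total-≈ ℤ.+-0-commutativeMonoid ⟨_, _ ⟩ (⟨,⟩-↭ sym-f) E≈F

⟶*⇒≐ : ∀ {E F} → E ⟶* F → E ≐ F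
⟶*⇒≐ ε            sym-f = refl
⟶*⇒≐ (E⟶F ◅ F⟶*G) sym-f = ≡-trans
  (Total.total-⟶ ℤ.+-0-commutativeMonoid ⟨_, _ ⟩ (⟨,⟩-↭ sym-f) (⟨,⟩-expands sym-f) E⟶F)
  (⟶*⇒≐ F⟶*G sym-f)

≐-cancel : ∀ {q E F} → q ∷ E ≐ q ∷ F → E ≐ F
≐-cancel {q} qE≐qF {f} sym-f =
  GroupProperties.∙-cancelˡ (AbelianGroup.group ℤ.+-0-abelianGroup) ⟨ q , f ⟩ _ _ (qE≐qF sym-f)

length-filter-∷ : ∀ {a p} {A : Set a} {P : Pred A p} (P? : Unary.Decidable P) x xs →
  (if does (P? x) then 1ℤ else 0ℤ) ℤ.+ + length (filter P? xs) ≡ + length (filter P? (x ∷ xs))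
length-filter-∷ P? x xs with does (P? x)
... | true  = refl
... | false = refl

-- The weight bound leaves each product only its leading monomial, which contributes 1 if it is that
-- of `q` and 0 otherwise.
sumPairing-leadingCoefficient : ∀ {q E} → All (λ p → weight p ≤ weight q) E →
  sumPairing (leadingCoefficient q) E ≡ + length (filter (sameEnds? q) E)
sumPairing-leadingCoefficient []                          = refl
sumPairing-leadingCoefficient {q} {p ∷ E} (p≤q ∷ E≤q) = ≡-trans
  (cong₂ ℤ._+_
    (⟨,⟩-leading p λ as bs light → leadingCoefficient-low q as bs (ℕ.<-≤-trans light p≤q))
    (sumPairing-leadingCoefficient E≤q))
  (length-filter-∷ (sameEnds? q) p E)

-- The coefficient of the leading monomial of `q` is a count in `E` and in `F`, so nothing cancels:
-- the counts agree, and the one in `E` is positive.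
heaviest-shared : ∀ {q E F} → E ≐ F →
  All (λ p → weight p ≤ weight q) E → All (λ p → weight p ≤ weight q) F →
  Any (SameEnds q) E → Any (SameEnds q) F
heaviest-shared {q} {E} {F} E≐F E≤q F≤q q∈E with any? (sameEnds? q) F
... | yes q∈F = q∈F
... | no q∉F  = contradiction count-E≡0 (ℕ.>⇒≢ (filter-some (sameEnds? q) q∈E))
  where
  count : Expression → ℕ
  count = length ∘ filter (sameEnds? q)

  count-E≡0 : count E ≡ 0
  count-E≡0 = begin
    count E       ≡⟨ ℤ.+-injective (begin
                       + count E  ≡⟨ sumPairing-leadingCoefficient E≤q ⟨
                       sumPairing (leadingCoefficient q) E
                                  ≡⟨ E≐F (leadingCoefficient-symmetric q) ⟩
                       sumPairing (leadingCoefficient q) F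
                                  ≡⟨ sumPairing-leadingCoefficient F≤q ⟩
                       + count F  ∎) ⟩
    count F       ≡⟨ cong length (filter-none (sameEnds? q) (¬Any⇒All¬ F q∉F)) ⟩
    0             ∎
    where open ≡-Reasoning

extract : ∀ {q E} → NonCrossing q → All NonCrossing E → Any (SameEnds q) E →
          ∃[ R ] E ≈ q ∷ R
extract q-nc E-nc q∈E with p , p∈E , ends ← find q∈E =
  Any-≈ (lose p∈E (sameEnds⇒↭ q-nc (All.lookup E-nc p∈E) ends))

heaviest-in : ∀ G → 0 < length G → ∃[ q ] (q ∈ G × All (λ p → weight p ≤ weight q) G)
heaviest-in (p ∷ G) _ =
  argmax weight p G , [ here , there ]′ (argmax-sel weight p G)
                    , f[⊥]≤f[argmax] {f = weight} p G ∷ f[xs]≤f[argmax] p G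

sameEnds-reflexive : ∀ {q p} → q ≡ p → SameEnds q p
sameEnds-reflexive refl = refl , refl

common-product : ∀ E F → 0 < length (E ++ F) → E ≐ F →
                 ∃[ q ] (q ∈ E ++ F × Any (SameEnds q) E × Any (SameEnds q) F)
common-product E F nonempty E≐F
  -- Maximizing over both expressions at once bounds the weights on both sides, whichever side `q`
  -- comes from.
  with q , q∈ , heaviest ← heaviest-in (E ++ F) nonempty
  with E≤q , F≤q ← ++⁻ E heaviest
  = q , q∈
  , [ (λ q∈E → let E∋q = Any.map sameEnds-reflexive q∈E in
         E∋q , heaviest-shared E≐F E≤q F≤q E∋q)
    , (λ q∈F → let F∋q = Any.map sameEnds-reflexive q∈F in
         heaviest-shared (≐-sym {E} {F} E≐F) F≤q E≤q F∋q , F∋q)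
    ]′ (∈-++⁻ E q∈)

-- Induction on the number of products: a heaviest product occurs on both sides, since its ends
-- determine it, and cancelling it preserves `≐`.
nonCrossing-independent : ∀ {E F} → All NonCrossing E → All NonCrossing F →
                          E ≐ F → E ≈ F
nonCrossing-independent {E} = go (<-wellFounded (length E))
  where
  go : ∀ {E F} → Acc _<_ (length E) →
       All NonCrossing E → All NonCrossing F → E ≐ F → E ≈ F
  go {[]}    {[]}    _ _ _ _ = ≈-refl
  go {[]}    {p ∷ F} _ _ _ E≐F with _ , _ , () , _ ← common-product [] (p ∷ F) (s≤s z≤n) E≐F
  go {p ∷ E} {F} (acc rs) E-nc F-nc E≐F
    with q , q∈ , E∋q , F∋q ← common-product (p ∷ E) F (s≤s z≤n) E≐F
    with q-nc ← All.lookup (++⁺ E-nc F-nc) q∈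
    with R , E≈ ← extract q-nc E-nc E∋q | S , F≈ ← extract q-nc F-nc F∋q
    = ≈-trans E≈ (≈-trans (↭-prep q R≈S) (≈-sym F≈))
    where
    tail-nc : ∀ {G T} → G ≈ q ∷ T → All NonCrossing G → All NonCrossing T
    tail-nc G≈ G-nc = All.tail (≈ₚ.All-resp-↭ NonCrossing-↭ G≈ G-nc)

    qR≐qS : q ∷ R ≐ q ∷ S
    qR≐qS sym-f = ≡-trans (≈⇒≐ (≈-sym E≈) sym-f) (≡-trans (E≐F sym-f) (≈⇒≐ F≈ sym-f))

    R≈S : R ≈ S
    R≈S = go (rs (ℕ.≤-reflexive (sym (≈ₚ.xs↭ys⇒|xs|≡|ys| E≈))))
             (tail-nc E≈ E-nc) (tail-nc F≈ F-nc) (≐-cancel {q} {R} {S} qR≐qS)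

theoremt : StronglyNormalizing _⟶_ ×
    (∀ (E : Expression) →
    ∃[ N ] (IsNormalForm _⟶_ N × E ⟶* N ×
    (∀ (N′ : Expression) → IsNormalForm _⟶_ N′ → E ⟶* N′ → N′ ≈ N)))
theoremt = ⟶-stronglyNormalizing , λ E →
  let N , N-nc , E⟶*N = normalize E in
  N , nonCrossing⇒normal N-nc , E⟶*N , λ N′ N′-nf E⟶*N′ →
    nonCrossing-independent (normal⇒nonCrossing N′-nf) N-nc
      -- Both normal forms have the polynomial of `E`.
      (λ sym-f → ≡-trans (sym (⟶*⇒≐ E⟶*N′ sym-f)) (⟶*⇒≐ E⟶*N sym-f))
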